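{- Let $p$ be a prime number. Then: (1) if $p\neq 2$, then $|\nu_{2p,Z(\mathbb{Z}_{2p})}| = |\nu_p| + p - 1$; (2) if $p\neq 3$, then $|\nu_{3p,Z(\mathbb{Z}_{3p})}| = |\nu_p| + p + \left\lceil\frac{p-1}{2}\right\rceil$.
   Context: For a positive integer $n$, elements of $\mathbb{Z}_n$ are identified with their representatives $0,1,\dots,n-1$. An unordered pair $\{a,b\}$ with $0\le a,b<n$ ($a=b$ allowed) is called a gcd-pair in $\mathbb{Z}_n$ if $\gcd(a,b)$ divides $n$. Here $\gcd(0,a)=a$ and $\gcd(0,0)=0$, so $\{0,0\}$ is not a gcd-pair. $\nu_n$ denotes the set of all gcd-pairs in $\mathbb{Z}_n$, and for $A\subseteq\mathbb{Z}_n$, $\nu_{n,A}$ denotes the set of those gcd-pairs $\{a,b\}\in\nu_n$ with $a,b\in A$. $Z(\mathbb{Z}_n)$ denotes the set of zero divisors of $\mathbb{Z}_n$, where the zero element is not counted as a zero divisor. -}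

module Defs where

open import Data.Nat using (ℕ; zero; suc; _*_; _≤?_) renaming (_≤_ to _≤ℕ_; _≟_ to _≟ℕ_)
open import Data.Nat.DivMod using (_mod_)
open import Data.Nat.Divisibility using (_∣_; _∣?_)
open import Data.Nat.GCD using (gcd)
open import Data.Fin using (Fin; toℕ)
open import Data.Fin.Properties using (any?)
open import Data.List using (length; filter; allFin; cartesianProduct)
open import Data.Product using (_×_; _,_; ∃-syntax)
open import Level using (0ℓ)
open import Relation.Binary.PropositionalEquality using (_≡_; _≢_)
open import Relation.Nullary using (¬?)
open import Relation.Nullary.Decidable using (_×-dec_)
open import Relation.Unary using (Pred; Decidable)

-- ℤₙ is Fin n, each residue being represented by toℕ a ∈ {0, …, n-1}.
infixl 7 _·_
_·_ : ∀ {n} → Fin n → Fin n → Fin n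
_·_ {suc m} a b = (toℕ a * toℕ b) mod suc m

-- The zero element is excluded.
ZeroDivisor : ∀ {n} → Pred (Fin n) 0ℓ
ZeroDivisor a = toℕ a ≢ 0 × ∃[ b ] (toℕ b ≢ 0 × toℕ (a · b) ≡ 0)

zeroDivisor? : ∀ {n} → Decidable (ZeroDivisor {n})
zeroDivisor? a =
  ¬? (toℕ a ≟ℕ 0) ×-dec
  any? (λ b → ¬? (toℕ b ≟ℕ 0) ×-dec (toℕ (a · b) ≟ℕ 0))

-- An unordered pair {a, b} (a = b allowed) is encoded by its unique
-- ordering (a , b) with a ≤ b, so that each one is counted exactly once.
-- In the library gcd 0 0 = 0, and 0 ∣ n only for n = 0.
ν : ∀ n → Pred (Fin n × Fin n) 0ℓ
ν n (a , b) = toℕ a ≤ℕ toℕ b × gcd (toℕ a) (toℕ b) ∣ n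

ν? : ∀ n → Decidable (ν n)
ν? n (a , b) = (toℕ a ≤? toℕ b) ×-dec (gcd (toℕ a) (toℕ b) ∣? n)

ν[_,_] : ∀ n → Pred (Fin n) 0ℓ → Pred (Fin n × Fin n) 0ℓ
ν[ n , A ] (a , b) = ν n (a , b) × A a × A b

ν[_,_]? : ∀ n {A : Pred (Fin n) 0ℓ} → Decidable A → Decidable ν[ n , A ]
ν[ n , A? ]? (a , b) = ν? n (a , b) ×-dec (A? a ×-dec A? b)

-- The list of all pairs has no repetitions, so this is the cardinality of P.
card : ∀ {n} (P : Pred (Fin n × Fin n) 0ℓ) → Decidable P → ℕ
card {n} P P? = length (filter P? (cartesianProduct (allFin n) (allFin n)))

{-# OPTIONS --safe #-}

-- For distinct primes q and p the zero divisors of ℤ_{qp} are the nonzero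
-- multiples of q and those of p, and no nonzero residue is both.
-- A pair {qi, qj} is a gcd-pair iff gcd(i, j) divides p, i.e. iff i and j are
-- coprime (as 0 < i < p), and likewise for {pk, pl}; a mixed pair {pk, qi} is
-- a gcd-pair iff k and i are coprime.  The gcd-pairs of ℤ_p are the coprime
-- ones with nonzero entries together with {0, 1}.  Hence
--   |ν_{qp,Z}| = (|ν_p| - 1) + (|ν_q| - 1) + #{(k, i) coprime, 0 < k < q, 0 < i < p},
-- and for q = 2, 3 the last term counts the i coprime to 1 and, if q = 3, to 2.

module Submission where

open import Data.Nat using (ℕ; zero; suc; _+_; _*_; _∸_; ⌈_/2⌉; ⌊_/2⌋; _⊓_; _⊔_; _≤_; _<_; _≤?_; NonZero; z≤n; z<s; s<s; s≤s; >-nonZero; >-nonZero⁻¹; ≢-nonZero⁻¹; nonTrivial⇒n>1)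
open import Data.Nat.Coprimality as Coprime using (Coprime; coprime?; prime⇒coprime; coprime⇒gcd≡1; gcd≡1⇒coprime)
open import Data.Nat.DivMod using (m%n<n)
open import Data.Nat.Divisibility
open import Data.Nat.GCD using (gcd; gcd-comm; gcd-greatest; gcd[m,n]∣m; gcd[m,n]∣n; c*gcd[m,n]≡gcd[cm,cn])
open import Data.Nat.Primality using (Prime; prime⇒nonZero; prime⇒nonTrivial; prime⇒irreducible; euclidsLemma; prime?)
open import Data.Nat.Properties
open import Data.Fin using (Fin; toℕ; fromℕ<)
open import Data.Fin.Properties using (toℕ-fromℕ<; toℕ-injective; toℕ<n)
open import Data.List using (List; []; _∷_; _++_; length; map; filter; applyUpTo; allFin; cartesianProduct)
open import Data.List.Membership.Propositional using (_∈_)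
open import Data.List.Membership.Propositional.Properties using (∈-map⁺; ∈-map⁻; ∈-++⁺ˡ; ∈-++⁺ʳ; ∈-++⁻; ∈-filter⁺; ∈-filter⁻; ∈-cartesianProduct⁺; ∈-cartesianProduct⁻; ∈-applyUpTo⁺; ∈-applyUpTo⁻; ∈-allFin)
open import Data.List.Membership.Propositional.Properties.WithK using (unique∧set⇒bag)
open import Data.List.Properties using (length-map; length-++; length-applyUpTo; filter-++; filter-all)
open import Data.List.Relation.Binary.BagAndSetEquality using (∼bag⇒↭)
open import Data.List.Relation.Binary.Permutation.Propositional.Properties using (↭-length)
open import Data.List.Relation.Unary.All as All using ([]; _∷_)
import Data.List.Relation.Unary.All.Properties as All
open import Data.List.Relation.Unary.AllPairs using ([]; _∷_)
open import Data.List.Relation.Unary.Any using (here; there)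
open import Data.List.Relation.Unary.Unique.Propositional using (Unique)
import Data.List.Relation.Unary.Unique.Propositional.Properties as Unique
open import Data.Product using (_×_; _,_; proj₁; proj₂; ∃-syntax)
open import Data.Product.Properties using (,-injective)
open import Data.Sum using (_⊎_; inj₁; inj₂; [_,_]′)
open import Function using (_∘_; _⇔_; mk⇔; Equivalence; case_of_)
open import Level using (0ℓ)
open import Relation.Binary.PropositionalEquality using (_≡_; _≢_; refl; sym; trans; cong; cong₂; subst; module ≡-Reasoning)
open import Relation.Nullary using (¬_; yes; no; contradiction)
open import Relation.Nullary.Decidable using (_×-dec_; from-yes)
open import Relation.Unary using (Pred; Decidable)
open import Defs

open Equivalence using (to; from)

private
  variable
    A B : Set
    a b i j k n p q : ℕ

-- Cardinalities as lengths of duplicate-free lists.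

-- Injectivity is asked only on members of the list, because `mix` below is shown injective only on
-- the coprime pairs in range.
unique-map⁺ : ∀ {f : A → B} {xs} →
              (∀ {x y} → x ∈ xs → y ∈ xs → f x ≡ f y → x ≡ y) →
              Unique xs → Unique (map f xs)
unique-map⁺ inj []       = []
unique-map⁺ inj (x∉ ∷ u) =
  All.map⁺ (All.tabulate λ y∈ eq → All.lookup x∉ y∈ (inj (here refl) (there y∈) eq))
  ∷ unique-map⁺ (λ x∈ y∈ → inj (there x∈) (there y∈)) u

unique∧set⇒length : ∀ {xs ys : List A} → Unique xs → Unique ys →
                    (∀ {x} → x ∈ xs ⇔ x ∈ ys) → length xs ≡ length ys
unique∧set⇒length u v eq = ↭-length (∼bag⇒↭ (unique∧set⇒bag u v eq))

length-filter-map : ∀ {P : Pred B 0ℓ} (P? : Decidable P) (f : A → B) xs →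
                    length (filter P? (map f xs)) ≡ length (filter (P? ∘ f) xs)
length-filter-map P? f []       = refl
length-filter-map P? f (x ∷ xs) with P? (f x)
... | yes _ = cong suc (length-filter-map P? f xs)
... | no  _ = length-filter-map P? f xs

toℕ² : Fin n × Fin n → ℕ × ℕ
toℕ² (a , b) = toℕ a , toℕ b

toℕ²-injective : ∀ {x y : Fin n × Fin n} → toℕ² x ≡ toℕ² y → x ≡ y
toℕ²-injective eq with eq₁ , eq₂ ← ,-injective eq =
  cong₂ _,_ (toℕ-injective eq₁) (toℕ-injective eq₂)

card≡length : ∀ {P : Pred (Fin n × Fin n) 0ℓ} (P? : Decidable P) {xs} → Unique xs →
              (∀ {x} → P x ⇔ toℕ² x ∈ xs) →
              (∀ {a b} → (a , b) ∈ xs → a < n × b < n) →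
              card P P? ≡ length xs
card≡length {n} {P} P? {xs} u P⇔∈ bounded =
  trans (sym (length-map toℕ² L)) (unique∧set⇒length uL u (mk⇔ ⇒ ⇐))
  where
  L = filter P? (cartesianProduct (allFin n) (allFin n))
  uL : Unique (map toℕ² L)
  uL = Unique.map⁺ toℕ²-injective
         (Unique.filter⁺ P? (Unique.cartesianProduct⁺ (Unique.allFin⁺ n) (Unique.allFin⁺ n)))
  ⇒ : ∀ {z} → z ∈ map toℕ² L → z ∈ xs
  ⇒ z∈ with _ , x∈ , refl ← ∈-map⁻ toℕ² z∈ = to P⇔∈ (proj₂ (∈-filter⁻ P? {xs = cartesianProduct (allFin n) (allFin n)} x∈))
  lift : ∀ {z} (x : Fin n × Fin n) → toℕ² x ≡ z → z ∈ xs → z ∈ map toℕ² L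
  lift (x , y) refl z∈ = ∈-map⁺ toℕ²
    (∈-filter⁺ P? (∈-cartesianProduct⁺ (∈-allFin x) (∈-allFin y)) (from P⇔∈ z∈))
  ⇐ : ∀ {z} → z ∈ xs → z ∈ map toℕ² L
  ⇐ z∈ with a<n , b<n ← bounded z∈ =
    lift (fromℕ< a<n , fromℕ< b<n) (cong₂ _,_ (toℕ-fromℕ< a<n) (toℕ-fromℕ< b<n)) z∈

-- Nonzero residues and lists of coprime pairs.

InRange : ℕ → Pred ℕ 0ℓ
InRange n i = 0 < i × i < n

range : ℕ → List ℕ
range n = applyUpTo suc (n ∸ 1)

∈-range : i ∈ range n ⇔ InRange n i
∈-range {n = n} = mk⇔ (⇒ n) ⇐
  where
  ⇒ : ∀ n {i} → i ∈ range n → InRange n i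
  ⇒ (suc n) i∈ with _ , i<n , refl ← ∈-applyUpTo⁻ suc i∈ = z<s , s<s i<n
  ⇐ : InRange n i → i ∈ range n
  ⇐ (z<s , s≤s i<n) = ∈-applyUpTo⁺ suc i<n

range-unique : ∀ n → Unique (range n)
range-unique n = Unique.applyUpTo⁺₁ suc (n ∸ 1) λ i<j _ → <⇒≢ (s<s i<j)

InRange-*⁺ : ∀ q .{{_ : NonZero q}} → InRange n i → InRange (q * n) (q * i)
InRange-*⁺ {n} {i} q@(suc _) (0<i , i<n) =
  subst (_< q * i) (*-zeroʳ q) (*-monoʳ-< q 0<i) , *-monoʳ-< q i<n

InRange-*⁻ : ∀ q → InRange (q * n) (q * i) → InRange n i
InRange-*⁻ {n} {i} q (0<qi , qi<qn) =
  *-cancelˡ-< q 0 i (subst (_< q * i) (sym (*-zeroʳ q)) 0<qi) , *-cancelˡ-< q i n qi<qn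

InRange⇒∤ : InRange n i → n ∤ i
InRange⇒∤ (0<i , i<n) = >⇒∤ {{>-nonZero 0<i}} i<n

CoprimePair≤ : Pred (ℕ × ℕ) 0ℓ
CoprimePair≤ (i , j) = i ≤ j × Coprime i j

coprimePair≤? : Decidable CoprimePair≤
coprimePair≤? (i , j) = (i ≤? j) ×-dec coprime? i j

coprimePairs≤ : ℕ → List (ℕ × ℕ)
coprimePairs≤ n = filter coprimePair≤? (cartesianProduct (range n) (range n))

coprimePair? : Decidable (λ ((i , j) : ℕ × ℕ) → Coprime i j)
coprimePair? (i , j) = coprime? i j

-- Ordered pairs, unlike `coprimePairs≤`: the two entries will be multiplied by different primes, so
-- their roles differ.
coprimePairs : ℕ → ℕ → List (ℕ × ℕ)
coprimePairs m n = filter coprimePair? (cartesianProduct (range m) (range n))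

∈-coprimePairs≤ : ∀ n → (i , j) ∈ coprimePairs≤ n ⇔ (CoprimePair≤ (i , j) × InRange n i × InRange n j)
∈-coprimePairs≤ {i} {j} n = mk⇔ ⇒ ⇐
  where
  ⇒ : (i , j) ∈ coprimePairs≤ n → CoprimePair≤ (i , j) × InRange n i × InRange n j
  ⇒ z∈ with z∈′ , c ← ∈-filter⁻ coprimePair≤? z∈
       with i∈ , j∈ ← ∈-cartesianProduct⁻ (range n) (range n) z∈′ =
    c , to ∈-range i∈ , to ∈-range j∈
  ⇐ : CoprimePair≤ (i , j) × InRange n i × InRange n j → (i , j) ∈ coprimePairs≤ n
  ⇐ (c , ri , rj) =
    ∈-filter⁺ coprimePair≤? (∈-cartesianProduct⁺ (from ∈-range ri) (from ∈-range rj)) c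

∈-coprimePairs : ∀ m n → (i , j) ∈ coprimePairs m n ⇔ (Coprime i j × InRange m i × InRange n j)
∈-coprimePairs {i} {j} m n = mk⇔ ⇒ ⇐
  where
  ⇒ : (i , j) ∈ coprimePairs m n → Coprime i j × InRange m i × InRange n j
  ⇒ z∈ with z∈′ , c ← ∈-filter⁻ coprimePair? z∈
       with i∈ , j∈ ← ∈-cartesianProduct⁻ (range m) (range n) z∈′ =
    c , to ∈-range i∈ , to ∈-range j∈
  ⇐ : Coprime i j × InRange m i × InRange n j → (i , j) ∈ coprimePairs m n
  ⇐ (c , ri , rj) =
    ∈-filter⁺ coprimePair? (∈-cartesianProduct⁺ (from ∈-range ri) (from ∈-range rj)) c

coprimePairs≤-unique : ∀ n → Unique (coprimePairs≤ n)
coprimePairs≤-unique n =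
  Unique.filter⁺ coprimePair≤? (Unique.cartesianProduct⁺ (range-unique n) (range-unique n))

coprimePairs-unique : ∀ m n → Unique (coprimePairs m n)
coprimePairs-unique m n =
  Unique.filter⁺ coprimePair? (Unique.cartesianProduct⁺ (range-unique m) (range-unique n))

-- Gcd-pairs modulo a prime.

-- The gcd is 1 or `p`, and `p` cannot divide `i` since `0 < i < p`.
prime∣range⇒coprime : Prime p → InRange p i → gcd i j ∣ p → Coprime i j
prime∣range⇒coprime {p} {i} {j} pp (0<i , i<p) g∣p with prime⇒irreducible pp g∣p
... | inj₁ g≡1 = gcd≡1⇒coprime g≡1
... | inj₂ g≡p = contradiction (subst (_∣ i) g≡p (gcd[m,n]∣m i j)) (InRange⇒∤ (0<i , i<p))

1<prime : Prime p → 1 < p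
1<prime {p} pp = nonTrivial⇒n>1 p {{prime⇒nonTrivial pp}}

-- The successor counts the pair {0, 1}, the only gcd-pair with a zero entry: gcd(0, b) = b, and the
-- only divisor of `p` below `p` is 1.
card-ν-prime : Prime p → card (ν p) (ν? p) ≡ suc (length (coprimePairs≤ p))
card-ν-prime {p} pp = card≡length (ν? p) unique (λ {x} → mk⇔ (⇒ x) (⇐ x)) bounded
  where
  unique : Unique ((0 , 1) ∷ coprimePairs≤ p)
  unique = All.tabulate (λ { z∈ refl → case proj₁ (proj₁ (proj₂ (to (∈-coprimePairs≤ p) z∈))) of λ () })
           ∷ coprimePairs≤-unique p
  bounded : ∀ {a b} → (a , b) ∈ (0 , 1) ∷ coprimePairs≤ p → a < p × b < p
  bounded (here refl) = <⇒≤ (1<prime pp) , 1<prime pp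
  bounded (there z∈) with _ , (_ , a<p) , (_ , b<p) ← to (∈-coprimePairs≤ p) z∈ = a<p , b<p
  ⇒ℕ : ∀ a b → a ≤ b → b < p → gcd a b ∣ p → (a , b) ∈ (0 , 1) ∷ coprimePairs≤ p
  ⇒ℕ zero zero _ 0<p g∣p = contradiction (0∣⇒≡0 g∣p) (≢-nonZero⁻¹ p {{prime⇒nonZero pp}})
  -- `suc b` divides both 0 and itself, hence divides the gcd and so `p`.
  ⇒ℕ zero (suc b) _ b<p g∣p with prime⇒irreducible pp (∣-trans (gcd-greatest (suc b ∣0) ∣-refl) g∣p)
  ... | inj₁ refl = here refl
  ... | inj₂ b≡p = contradiction b≡p (<⇒≢ b<p)
  ⇒ℕ a@(suc _) b a≤b b<p g∣p = there (from (∈-coprimePairs≤ p)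
    ((a≤b , prime∣range⇒coprime pp ra g∣p) , ra , <-≤-trans z<s a≤b , b<p))
    where ra = z<s , ≤-<-trans a≤b b<p
  ⇒ : ∀ x → ν p x → toℕ² x ∈ (0 , 1) ∷ coprimePairs≤ p
  ⇒ (a , b) (a≤b , g∣p) = ⇒ℕ (toℕ a) (toℕ b) a≤b (toℕ<n b) g∣p
  ⇐ℕ : ∀ {a b} → (a , b) ∈ (0 , 1) ∷ coprimePairs≤ p → a ≤ b × gcd a b ∣ p
  ⇐ℕ (here refl) = z≤n , 1∣ p
  ⇐ℕ (there z∈) with (a≤b , c) , _ ← to (∈-coprimePairs≤ p) z∈ =
    a≤b , subst (_∣ p) (sym (coprime⇒gcd≡1 c)) (1∣ p)
  ⇐ : ∀ x → toℕ² x ∈ (0 , 1) ∷ coprimePairs≤ p → ν p x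
  ⇐ (a , b) = ⇐ℕ

-- Zero divisors of ℤ_{qp}.

toℕ-·≡0⇔∣ : ∀ (a b : Fin n) → toℕ (a · b) ≡ 0 ⇔ n ∣ toℕ a * toℕ b
toℕ-·≡0⇔∣ {suc m} a b rewrite toℕ-fromℕ< (m%n<n (toℕ a * toℕ b) (suc m)) = m%n≡0⇔n∣m _ _

prime∧∤⇒∣ : ∀ m n → Prime p → p ∤ m → p ∣ m * n → p ∣ n
prime∧∤⇒∣ m n pp p∤m p∣mn = [ (λ p∣m → contradiction p∣m p∤m) , (λ p∣n → p∣n) ]′ (euclidsLemma m n pp p∣mn)

-- If neither prime divides `a`, then `a` can be cancelled modulo `q * p`, so `a · b` vanishes only
-- for `b` zero. Otherwise the other prime is an annihilating factor.
zeroDivisor⇔ : Prime q → Prime p → (a : Fin (q * p)) →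
               ZeroDivisor a ⇔ (InRange (q * p) (toℕ a) × (q ∣ toℕ a ⊎ p ∣ toℕ a))
zeroDivisor⇔ {q} {p} pq pp a = mk⇔ ⇒ ⇐
  where
  instance
    q≢0 = prime⇒nonZero pq
    p≢0 = prime⇒nonZero pp
  q*p∣ : ∀ m n → q ∤ m → p ∤ m → q * p ∣ m * n → q * p ∣ n
  -- First `q` is split off from `n`, giving `n = c * q`; cancelling `q` then leaves `p ∣ m * c`,
  -- whence `p ∣ c`.
  q*p∣ m n q∤m p∤m qp∣mn
    with divides-refl c ← prime∧∤⇒∣ m n pq q∤m (m*n∣⇒m∣ q p qp∣mn) =
    subst (q * p ∣_) (*-comm q c) (*-monoʳ-∣ q (prime∧∤⇒∣ m c pp p∤m
      (*-cancelˡ-∣ q (subst (q * p ∣_) m*[c*q]≡q*[m*c] qp∣mn))))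
    where
    m*[c*q]≡q*[m*c] : m * (c * q) ≡ q * (m * c)
    m*[c*q]≡q*[m*c] = trans (sym (*-assoc m c q)) (*-comm (m * c) q)
  ⇒ : ZeroDivisor a → InRange (q * p) (toℕ a) × (q ∣ toℕ a ⊎ p ∣ toℕ a)
  ⇒ (a≢0 , b , b≢0 , ab≡0) with q ∣? toℕ a | p ∣? toℕ a
  ... | yes q∣a | _       = (n≢0⇒n>0 a≢0 , toℕ<n a) , inj₁ q∣a
  ... | no  _   | yes p∣a = (n≢0⇒n>0 a≢0 , toℕ<n a) , inj₂ p∣a
  ... | no  q∤a | no  p∤a = contradiction
    (q*p∣ (toℕ a) (toℕ b) q∤a p∤a (to (toℕ-·≡0⇔∣ a b) ab≡0))
    (InRange⇒∤ (n≢0⇒n>0 b≢0 , toℕ<n b))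
  witness : InRange (q * p) n → q * p ∣ toℕ a * n → ∃[ b ] (toℕ b ≢ 0 × toℕ (a · b) ≡ 0)
  witness (0<n , n<qp) qp∣an = fromℕ< n<qp
    , (λ eq → <⇒≢ 0<n (sym (trans (sym (toℕ-fromℕ< n<qp)) eq)))
    , from (toℕ-·≡0⇔∣ a _) (subst (λ x → q * p ∣ toℕ a * x) (sym (toℕ-fromℕ< n<qp)) qp∣an)
  ⇐ : InRange (q * p) (toℕ a) × (q ∣ toℕ a ⊎ p ∣ toℕ a) → ZeroDivisor a
  -- The witness is `p`, which lies below `q * p` because `1 < q`; in the next clause it is `q`.
  ⇐ ((0<a , _) , inj₁ q∣a) = (λ eq → <⇒≢ 0<a (sym eq)) , witness
    (>-nonZero⁻¹ p , subst (p <_) (*-comm p q) (m<m*n p q (1<prime pq)))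
    (*-monoˡ-∣ p q∣a)
  ⇐ ((0<a , _) , inj₂ p∣a) = (λ eq → <⇒≢ 0<a (sym eq)) , witness
    (>-nonZero⁻¹ q , m<m*n q p (1<prime pp))
    (subst (_∣ toℕ a * q) (*-comm p q) (*-monoˡ-∣ q p∣a))

-- Sorted pairs, and pairs of multiples of the same prime.

-- Which of `p * k` and `q * i` is smaller depends on `k` and `i`, whereas `ν` contains only the
-- ordering with the smaller entry first.
sortPair : ℕ → ℕ → ℕ × ℕ
sortPair a b = a ⊓ b , a ⊔ b

sortPair-≤ : a ≤ b → sortPair a b ≡ (a , b)
sortPair-≤ a≤b = cong₂ _,_ (m≤n⇒m⊓n≡m a≤b) (m≤n⇒m⊔n≡n a≤b)

sortPair-comm : ∀ a b → sortPair a b ≡ sortPair b a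
sortPair-comm a b = cong₂ _,_ (⊓-comm a b) (⊔-comm a b)

sortPair-cases : ∀ a b → a ≤ b × sortPair a b ≡ (a , b) ⊎ b ≤ a × sortPair a b ≡ (b , a)
sortPair-cases a b with ≤-total a b
... | inj₁ a≤b = inj₁ (a≤b , sortPair-≤ a≤b)
... | inj₂ b≤a = inj₂ (b≤a , trans (sortPair-comm a b) (sortPair-≤ b≤a))

-- A common divisor of `i * j` and `k` is coprime to `i`, being a divisor of `k`; hence it divides
-- `j`.
coprime-*ˡ : Coprime i k → Coprime j k → Coprime (i * j) k
coprime-*ˡ i⊥k j⊥k (d∣ij , d∣k) =
  j⊥k (Coprime.coprime-divisor (λ (e∣d , e∣i) → i⊥k (e∣i , ∣-trans e∣d d∣k)) d∣ij , d∣k)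

prime⇒coprimeInRange : Prime p → InRange p i → Coprime p i
prime⇒coprimeInRange pp (0<i , i<p) = prime⇒coprime pp {{>-nonZero 0<i}} i<p

multipleInRange : ∀ q n → q ∣ a → InRange (q * n) a → ∃[ i ] (InRange n i × a ≡ q * i)
multipleInRange q n (divides-refl i) r rewrite *-comm i q = i , InRange-*⁻ q r , refl

PairOfMultiples : ℕ → ℕ → Pred (ℕ × ℕ) 0ℓ
PairOfMultiples q p (a , b) =
  (a ≤ b × gcd a b ∣ q * p) × (InRange (q * p) a × q ∣ a) × (InRange (q * p) b × q ∣ b)

scale : ℕ → ℕ × ℕ → ℕ × ℕ
scale q (i , j) = q * i , q * j

-- Since gcd(qi, qj) = q gcd(i, j), the factor `q` cancels from the divisibility and leaves gcd(i,
-- j) dividing `p`.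
∈-scaled : .{{_ : NonZero q}} → Prime p →
           (a , b) ∈ map (scale q) (coprimePairs≤ p) ⇔ PairOfMultiples q p (a , b)
∈-scaled {q} {p} pp = mk⇔ ⇒ ⇐
  where
  ⇒ : (a , b) ∈ map (scale q) (coprimePairs≤ p) → PairOfMultiples q p (a , b)
  ⇒ z∈ with (i , j) , ij∈ , refl ← ∈-map⁻ (scale q) z∈
       with (i≤j , i⊥j) , ri , rj ← to (∈-coprimePairs≤ p) ij∈ =
    (*-monoʳ-≤ q i≤j , subst (_∣ q * p) (c*gcd[m,n]≡gcd[cm,cn] q i j)
                         (*-monoʳ-∣ q (subst (_∣ p) (sym (coprime⇒gcd≡1 i⊥j)) (1∣ p))))
    , (InRange-*⁺ q ri , m∣m*n i) , (InRange-*⁺ q rj , m∣m*n j)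
  ⇐ : PairOfMultiples q p (a , b) → (a , b) ∈ map (scale q) (coprimePairs≤ p)
  ⇐ ((a≤b , g∣qp) , (ra , q∣a) , (rb , q∣b))
    with i , ri , refl ← multipleInRange q p q∣a ra
       | j , rj , refl ← multipleInRange q p q∣b rb =
    ∈-map⁺ (scale q) (from (∈-coprimePairs≤ p)
      ( (*-cancelˡ-≤ q a≤b
        , prime∣range⇒coprime pp ri
            (*-cancelˡ-∣ q (subst (_∣ q * p) (sym (c*gcd[m,n]≡gcd[cm,cn] q i j)) g∣qp)))
      , ri , rj))

scaled-unique : ∀ q .{{_ : NonZero q}} p → Unique (map (scale q) (coprimePairs≤ p))
scaled-unique q p = Unique.map⁺
  (λ eq → let eq₁ , eq₂ = ,-injective eq in cong₂ _,_ (*-cancelˡ-≡ _ _ q eq₁) (*-cancelˡ-≡ _ _ q eq₂))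
  (coprimePairs≤-unique p)

-- Mixed pairs and the total count for two distinct primes.

module _ (pq : Prime q) (pp : Prime p) (p≢q : p ≢ q) where

  private instance
    q-nonZero = prime⇒nonZero pq
    p-nonZero = prime⇒nonZero pp

  distinct⇒coprime : Coprime p q
  distinct⇒coprime (d∣p , d∣q) with prime⇒irreducible pp d∣p
  ... | inj₁ d≡1  = d≡1
  ... | inj₂ refl with prime⇒irreducible pq d∣q
  ...   | inj₁ d≡1 = d≡1
  ...   | inj₂ p≡q = contradiction p≡q p≢q

  -- Writing `a = q * i` with `0 < i < p`, coprimality of `p` and `q` would force `p ∣ i`. This
  -- keeps the three lists of pairs disjoint and makes `mix` injective.
  no-commonMultiple : InRange (q * p) a → q ∣ a → ¬ p ∣ a
  no-commonMultiple ra q∣a p∣a with i , ri , refl ← multipleInRange q p q∣a ra =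
    InRange⇒∤ ri (Coprime.coprime-divisor distinct⇒coprime p∣a)

  gcd∣⇔coprime : InRange q k → InRange p i → gcd (p * k) (q * i) ∣ q * p ⇔ Coprime k i
  gcd∣⇔coprime {k} {i} rk ri = mk⇔ ⇒ ⇐
    where
    ⇒ : gcd (p * k) (q * i) ∣ q * p → Coprime k i
    -- gcd(k, i) divides gcd(pk, qi), hence `p * q`; as a divisor of `i < p` it is coprime to `p`,
    -- so it divides `q`.
    ⇒ g∣qp = prime∣range⇒coprime pq rk (Coprime.coprime-divisor
      (λ (e∣g , e∣p) → prime⇒coprimeInRange pp ri (e∣p , ∣-trans e∣g (gcd[m,n]∣n k i)))
      (subst (gcd k i ∣_) (*-comm q p) (∣-trans
        (gcd-greatest (∣n⇒∣m*n p (gcd[m,n]∣m k i)) (∣n⇒∣m*n q (gcd[m,n]∣n k i))) g∣qp)))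
    ⇐ : Coprime k i → gcd (p * k) (q * i) ∣ q * p
    ⇐ k⊥i = subst (_∣ q * p) (sym (coprime⇒gcd≡1 pk⊥qi)) (1∣ (q * p))
      where
      pk⊥qi : Coprime (p * k) (q * i)
      -- Each of `p` and `k` is coprime to each of `q` and `i`.
      pk⊥qi = Coprime.sym (coprime-*ˡ
        (Coprime.sym (coprime-*ˡ distinct⇒coprime (Coprime.sym (prime⇒coprimeInRange pq rk))))
        (Coprime.sym (coprime-*ˡ (prime⇒coprimeInRange pp ri) k⊥i)))

  -- Arguments are placed by role, the multiple of `p` first, and not by size; a sorted pair may
  -- therefore be mixed in either orientation.
  MixedPair : ℕ → ℕ → Set
  MixedPair a b = gcd a b ∣ q * p × (InRange (q * p) a × p ∣ a) × (InRange (q * p) b × q ∣ b)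

  mix : ℕ × ℕ → ℕ × ℕ
  mix (k , i) = sortPair (p * k) (q * i)

  mixedPairs : List (ℕ × ℕ)
  mixedPairs = map mix (coprimePairs q p)

  coprimePair⇒mixed : (k , i) ∈ coprimePairs q p → MixedPair (p * k) (q * i)
  coprimePair⇒mixed {k} {i} ki∈ with k⊥i , rk , ri ← to (∈-coprimePairs q p) ki∈ =
    from (gcd∣⇔coprime rk ri) k⊥i
    , (subst (λ n → InRange n (p * k)) (*-comm p q) (InRange-*⁺ p rk) , m∣m*n k)
    , (InRange-*⁺ q ri , m∣m*n i)

  ∈-mixed⁻ : (a , b) ∈ mixedPairs → a ≤ b × (MixedPair a b ⊎ MixedPair b a)
  ∈-mixed⁻ z∈ with (k , i) , ki∈ , z≡ ← ∈-map⁻ mix z∈ with sortPair-cases (p * k) (q * i)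
  ... | inj₁ (pk≤qi , e) with refl , refl ← ,-injective (trans z≡ e) =
    pk≤qi , inj₁ (coprimePair⇒mixed ki∈)
  ... | inj₂ (qi≤pk , e) with refl , refl ← ,-injective (trans z≡ e) =
    qi≤pk , inj₂ (coprimePair⇒mixed ki∈)

  ∈-mixed⁺ : MixedPair a b → sortPair a b ∈ mixedPairs
  ∈-mixed⁺ {a} (g∣qp , (ra , p∣a) , (rb , q∣b))
    with k , rk , refl ← multipleInRange p q p∣a (subst (λ n → InRange n a) (*-comm q p) ra)
       | i , ri , refl ← multipleInRange q p q∣b rb =
    ∈-map⁺ mix (from (∈-coprimePairs q p) (to (gcd∣⇔coprime rk ri) g∣qp , rk , ri))

  mixed-unique : Unique mixedPairs
  mixed-unique = unique-map⁺ mix-injective (coprimePairs-unique q p)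
    where
    pk≢qj : (k , i) ∈ coprimePairs q p → p * k ≢ q * j
    pk≢qj {j = j} x∈ pk≡qj with _ , (rk , p∣pk) , _ ← coprimePair⇒mixed x∈ =
      no-commonMultiple rk (subst (q ∣_) (sym pk≡qj) (m∣m*n j)) p∣pk
    mix-injective : ∀ {x y} → x ∈ coprimePairs q p → y ∈ coprimePairs q p → mix x ≡ mix y → x ≡ y
    mix-injective {k , i} {l , j} x∈ y∈ eq
      with sortPair-cases (p * k) (q * i) | sortPair-cases (p * l) (q * j)
    ... | inj₁ (_ , e) | inj₁ (_ , f) with eq₁ , eq₂ ← ,-injective (trans (sym e) (trans eq f)) =
      cong₂ _,_ (*-cancelˡ-≡ k l p eq₁) (*-cancelˡ-≡ i j q eq₂)
    ... | inj₂ (_ , e) | inj₂ (_ , f) with eq₁ , eq₂ ← ,-injective (trans (sym e) (trans eq f)) =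
      cong₂ _,_ (*-cancelˡ-≡ k l p eq₂) (*-cancelˡ-≡ i j q eq₁)
    -- If the two pairs are sorted in opposite orders, a multiple of `p` equals a multiple of `q`,
    -- which is impossible in range.
    ... | inj₁ (_ , e) | inj₂ (_ , f) =
      contradiction (proj₁ (,-injective (trans (sym e) (trans eq f)))) (pk≢qj x∈)
    ... | inj₂ (_ , e) | inj₁ (_ , f) =
      contradiction (proj₂ (,-injective (trans (sym e) (trans eq f)))) (pk≢qj x∈)

  ZeroDivisorℕ : Pred ℕ 0ℓ
  ZeroDivisorℕ a = InRange (q * p) a × (q ∣ a ⊎ p ∣ a)

  ZeroDivisorPair : Pred (ℕ × ℕ) 0ℓ
  ZeroDivisorPair (a , b) = (a ≤ b × gcd a b ∣ q * p) × ZeroDivisorℕ a × ZeroDivisorℕ b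

  qMultiples pMultiples zeroDivisorPairs : List (ℕ × ℕ)
  qMultiples = map (scale q) (coprimePairs≤ p)
  pMultiples = map (scale p) (coprimePairs≤ q)
  zeroDivisorPairs = qMultiples ++ pMultiples ++ mixedPairs

  -- This is `∈-scaled` with the primes exchanged, after commuting the modulus.
  ∈-pMultiples : (a , b) ∈ pMultiples ⇔
    ((a ≤ b × gcd a b ∣ q * p) × (InRange (q * p) a × p ∣ a) × (InRange (q * p) b × p ∣ b))
  ∈-pMultiples rewrite *-comm q p = ∈-scaled pq

  ∈-zeroDivisorPairs : (a , b) ∈ zeroDivisorPairs ⇔ ZeroDivisorPair (a , b)
  ∈-zeroDivisorPairs {a} {b} = mk⇔ ⇒ ⇐
    where
    ⇒mixed : (a , b) ∈ mixedPairs → ZeroDivisorPair (a , b)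
    ⇒mixed z∈ with ∈-mixed⁻ z∈
    ... | a≤b , inj₁ (g∣ , (ra , p∣a) , (rb , q∣b)) =
      (a≤b , g∣) , (ra , inj₂ p∣a) , (rb , inj₁ q∣b)
    ... | a≤b , inj₂ (g∣ , (rb , p∣b) , (ra , q∣a)) =
      (a≤b , subst (_∣ q * p) (gcd-comm b a) g∣) , (ra , inj₁ q∣a) , (rb , inj₂ p∣b)
    ⇒ : (a , b) ∈ zeroDivisorPairs → ZeroDivisorPair (a , b)
    ⇒ z∈ with ∈-++⁻ qMultiples z∈
    ... | inj₁ z∈₁ with g , (ra , q∣a) , (rb , q∣b) ← to (∈-scaled pp) z∈₁ =
      g , (ra , inj₁ q∣a) , (rb , inj₁ q∣b)
    ... | inj₂ z∈₂ with ∈-++⁻ pMultiples z∈₂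
    ...   | inj₁ z∈₃ with g , (ra , p∣a) , (rb , p∣b) ← to ∈-pMultiples z∈₃ =
      g , (ra , inj₂ p∣a) , (rb , inj₂ p∣b)
    ...   | inj₂ z∈₄ = ⇒mixed z∈₄
    ⇐ : ZeroDivisorPair (a , b) → (a , b) ∈ zeroDivisorPairs
    ⇐ (g , (ra , inj₁ q∣a) , (rb , inj₁ q∣b)) =
      ∈-++⁺ˡ (from (∈-scaled pp) (g , (ra , q∣a) , (rb , q∣b)))
    ⇐ (g , (ra , inj₂ p∣a) , (rb , inj₂ p∣b)) =
      ∈-++⁺ʳ qMultiples (∈-++⁺ˡ (from ∈-pMultiples (g , (ra , p∣a) , (rb , p∣b))))
    ⇐ ((a≤b , g∣) , (ra , inj₂ p∣a) , (rb , inj₁ q∣b)) =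
      ∈-++⁺ʳ qMultiples (∈-++⁺ʳ pMultiples (subst (_∈ mixedPairs) (sortPair-≤ a≤b)
        (∈-mixed⁺ (g∣ , (ra , p∣a) , (rb , q∣b)))))
    ⇐ ((a≤b , g∣) , (ra , inj₁ q∣a) , (rb , inj₂ p∣b)) =
      ∈-++⁺ʳ qMultiples (∈-++⁺ʳ pMultiples (subst (_∈ mixedPairs) (trans (sortPair-comm b a) (sortPair-≤ a≤b))
        (∈-mixed⁺ (subst (_∣ q * p) (gcd-comm a b) g∣ , (rb , p∣b) , (ra , q∣a)))))

  zeroDivisorPairs-unique : Unique zeroDivisorPairs
  zeroDivisorPairs-unique =
    Unique.++⁺ (scaled-unique q p)
      (Unique.++⁺ (scaled-unique p q) mixed-unique (λ (z∈ , z∈′) → p#mixed z∈ z∈′))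
      (λ (z∈ , z∈′) → [ q#p z∈ , q#mixed z∈ ]′ (∈-++⁻ pMultiples z∈′))
    where
    q#p : ∀ {z} → z ∈ qMultiples → ¬ z ∈ pMultiples
    q#p z∈ z∈′ with _ , (ra , q∣a) , _ ← to (∈-scaled pp) z∈ | _ , (_ , p∣a) , _ ← to ∈-pMultiples z∈′ =
      no-commonMultiple ra q∣a p∣a
    q#mixed : ∀ {z} → z ∈ qMultiples → ¬ z ∈ mixedPairs
    q#mixed z∈ z∈′ with ∈-mixed⁻ z∈′ | to (∈-scaled pp) z∈
    -- In either orientation the entry divisible by `p` is also divisible by `q`, as a member of
    -- `qMultiples`.
    ... | _ , inj₁ (_ , (ra , p∣a) , _) | _ , (_ , q∣a) , _ = no-commonMultiple ra q∣a p∣a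
    ... | _ , inj₂ (_ , (rb , p∣b) , _) | _ , _ , (_ , q∣b) = no-commonMultiple rb q∣b p∣b
    p#mixed : ∀ {z} → z ∈ pMultiples → ¬ z ∈ mixedPairs
    p#mixed z∈ z∈′ with ∈-mixed⁻ z∈′ | to ∈-pMultiples z∈
    ... | _ , inj₁ (_ , _ , (rb , q∣b)) | _ , _ , (_ , p∣b) = no-commonMultiple rb q∣b p∣b
    ... | _ , inj₂ (_ , _ , (ra , q∣a)) | _ , (_ , p∣a) , _ = no-commonMultiple ra q∣a p∣a

  -- The summands count the pairs of multiples of `q`, the pairs of multiples of `p` and the mixed
  -- pairs.
  card-ν-zeroDivisor : card ν[ q * p , ZeroDivisor ] ν[ q * p , zeroDivisor? ]? ≡
    length (coprimePairs≤ p) + (length (coprimePairs≤ q) + length (coprimePairs q p))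
  card-ν-zeroDivisor = begin
    card ν[ q * p , ZeroDivisor ] ν[ q * p , zeroDivisor? ]?
      ≡⟨ card≡length ν[ q * p , zeroDivisor? ]? zeroDivisorPairs-unique
           (λ {x} → mk⇔ (⇒ x) (⇐ x)) bounded ⟩
    length zeroDivisorPairs
      ≡⟨ length-++ qMultiples ⟩
    length qMultiples + length (pMultiples ++ mixedPairs)
      ≡⟨ cong (length qMultiples +_) (length-++ pMultiples) ⟩
    length qMultiples + (length pMultiples + length mixedPairs)
      ≡⟨ cong₂ _+_ (length-map (scale q) (coprimePairs≤ p))
           (cong₂ _+_ (length-map (scale p) (coprimePairs≤ q)) (length-map mix (coprimePairs q p))) ⟩
    length (coprimePairs≤ p) + (length (coprimePairs≤ q) + length (coprimePairs q p)) ∎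
    where
    open ≡-Reasoning
    ⇒ : ∀ x → ν[ q * p , ZeroDivisor ] x → toℕ² x ∈ zeroDivisorPairs
    ⇒ (a , b) (g , za , zb) =
      from ∈-zeroDivisorPairs (g , to (zeroDivisor⇔ pq pp a) za , to (zeroDivisor⇔ pq pp b) zb)
    ⇐ : ∀ x → toℕ² x ∈ zeroDivisorPairs → ν[ q * p , ZeroDivisor ] x
    ⇐ (a , b) z∈ with g , za , zb ← to ∈-zeroDivisorPairs z∈ =
      g , from (zeroDivisor⇔ pq pp a) za , from (zeroDivisor⇔ pq pp b) zb
    bounded : (a , b) ∈ zeroDivisorPairs → a < q * p × b < q * p
    bounded z∈ with _ , ((_ , a<qp) , _) , ((_ , b<qp) , _) ← to ∈-zeroDivisorPairs z∈ = a<qp , b<qp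

-- Counting coprime pairs row by row.

length-coprimeRows : ∀ m ms xs →
  length (filter coprimePair? (cartesianProduct (m ∷ ms) xs)) ≡
  length (filter (coprime? m) xs) + length (filter coprimePair? (cartesianProduct ms xs))
length-coprimeRows m ms xs = begin
  length (filter coprimePair? (row ++ rows))
    ≡⟨ cong length (filter-++ coprimePair? row rows) ⟩
  length (filter coprimePair? row ++ filter coprimePair? rows)
    ≡⟨ length-++ (filter coprimePair? row) ⟩
  length (filter coprimePair? row) + length (filter coprimePair? rows)
    ≡⟨ cong (_+ length (filter coprimePair? rows)) (length-filter-map coprimePair? (m ,_) xs) ⟩
  length (filter (coprime? m) xs) + length (filter coprimePair? rows) ∎
  where
  open ≡-Reasoning
  row  = map (m ,_) xs
  rows = cartesianProduct ms xs

length-coprimeTo-1 : ∀ n → length (filter (coprime? 1) (range n)) ≡ n ∸ 1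
length-coprimeTo-1 n = trans
  (cong length (filter-all (coprime? 1) (All.universal Coprime.1-coprimeTo (range n))))
  (length-applyUpTo suc (n ∸ 1))

module _ {P : Pred ℕ 0ℓ} (P? : Decidable P) where

  Alternates : (ℕ → ℕ) → Set
  Alternates f = ∀ i → (P (f i) → ¬ P (f (suc i))) × (¬ P (f i) → P (f (suc i)))

  -- Dropping the first term turns either case into the other. The counts agree by computation:
  -- ⌈(n+1)/2⌉ = 1 + ⌊n/2⌋ and ⌊(n+1)/2⌋ = ⌈n/2⌉.
  length-filter-alternating-⌈⌉ : ∀ f n → Alternates f → P (f 0) →
    length (filter P? (applyUpTo f n)) ≡ ⌈ n /2⌉
  length-filter-alternating-⌊⌋ : ∀ f n → Alternates f → ¬ P (f 0) →
    length (filter P? (applyUpTo f n)) ≡ ⌊ n /2⌋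

  length-filter-alternating-⌈⌉ f zero    alt pf = refl
  length-filter-alternating-⌈⌉ f (suc n) alt pf with P? (f 0)
  ... | yes _  = cong suc (length-filter-alternating-⌊⌋ (f ∘ suc) n (alt ∘ suc) (proj₁ (alt 0) pf))
  ... | no ¬pf = contradiction pf ¬pf

  length-filter-alternating-⌊⌋ f zero    alt ¬pf = refl
  length-filter-alternating-⌊⌋ f (suc n) alt ¬pf with P? (f 0)
  ... | yes pf = contradiction pf ¬pf
  ... | no _   = length-filter-alternating-⌈⌉ (f ∘ suc) n (alt ∘ suc) (proj₂ (alt 0) ¬pf)

prime[2] : Prime 2
prime[2] = from-yes (prime? 2)

prime[3] : Prime 3
prime[3] = from-yes (prime? 3)

2∣⇒¬coprime : 2 ∣ n → ¬ Coprime 2 n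
2∣⇒¬coprime 2∣n 2⊥n = case 2⊥n (∣-refl , 2∣n) of λ ()

-- Being coprime to 2 means being odd, and parity alternates.
coprimeTo-2-alternates : Alternates (coprime? 2) suc
coprimeTo-2-alternates i = coprime⇒¬coprime , ¬coprime⇒coprime
  where
  2∤⇒coprime : 2 ∤ n → Coprime 2 n
  2∤⇒coprime 2∤n (d∣2 , d∣n) with prime⇒irreducible prime[2] d∣2
  ... | inj₁ d≡1  = d≡1
  ... | inj₂ refl = contradiction d∣n 2∤n
  2∤n⇒2∣1+n : ∀ n → 2 ∤ n → 2 ∣ suc n
  2∤n⇒2∣1+n zero          2∤n = contradiction (2 ∣0) 2∤n
  2∤n⇒2∣1+n (suc zero)    2∤n = ∣-refl
  2∤n⇒2∣1+n (suc (suc n)) 2∤n = ∣m∣n⇒∣m+n ∣-refl (2∤n⇒2∣1+n n (2∤n ∘ ∣m∣n⇒∣m+n ∣-refl))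
  coprime⇒¬coprime : Coprime 2 (suc i) → ¬ Coprime 2 (suc (suc i))
  coprime⇒¬coprime c = 2∣⇒¬coprime (2∤n⇒2∣1+n (suc i) (λ 2∣n → 2∣⇒¬coprime 2∣n c))
  ¬coprime⇒coprime : ¬ Coprime 2 (suc i) → Coprime 2 (suc (suc i))
  -- If 2 divided both consecutive numbers, it would divide their difference 1.
  ¬coprime⇒coprime ¬c = 2∤⇒coprime λ 2∣2+i → ¬c (2∤⇒coprime λ 2∣1+i →
    case ∣⇒≤ (∣m+n∣m⇒∣n {2} {suc i} {1} (subst (2 ∣_) (sym (+-comm (suc i) 1)) 2∣2+i) 2∣1+i) of λ { (s≤s ()) })

-- The range starts at the odd number 1, so the half is rounded up.
length-coprimeTo-2 : ∀ n → length (filter (coprime? 2) (range n)) ≡ ⌈ n ∸ 1 /2⌉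
length-coprimeTo-2 n = length-filter-alternating-⌈⌉ (coprime? 2) suc (n ∸ 1)
  coprimeTo-2-alternates (Coprime.sym (Coprime.1-coprimeTo 2))

-- The formulas for the moduli 2p and 3p.

corollary3p8 : (p : ℕ) → Prime p →
    (p ≢ 2 → card ν[ 2 * p , ZeroDivisor ] ν[ 2 * p , zeroDivisor? ]? ≡ card (ν p) (ν? p) + (p ∸ 1))
    × (p ≢ 3 → card ν[ 3 * p , ZeroDivisor ] ν[ 3 * p , zeroDivisor? ]? ≡ card (ν p) (ν? p) + p + ⌈ p ∸ 1 /2⌉)
corollary3p8 p pp = part₁ , part₂
  where
  open ≡-Reasoning
  instance p-nonZero = prime⇒nonZero pp
  C = length (coprimePairs≤ p)
  h = ⌈ p ∸ 1 /2⌉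
  part₁ : p ≢ 2 → card ν[ 2 * p , ZeroDivisor ] ν[ 2 * p , zeroDivisor? ]? ≡ card (ν p) (ν? p) + (p ∸ 1)
  part₁ p≢2 = begin
    card ν[ 2 * p , ZeroDivisor ] ν[ 2 * p , zeroDivisor? ]?
      ≡⟨ card-ν-zeroDivisor prime[2] pp p≢2 ⟩
    -- The 1 is the length of `coprimePairs≤ 2`, whose only element is (1, 1). It later completes
    -- `C` to |ν_p|, standing in for the pair {0, 1}.
    C + (1 + length (coprimePairs 2 p))
      ≡⟨ cong (λ x → C + (1 + x)) (trans (length-coprimeRows 1 [] (range p)) (+-identityʳ _)) ⟩
    C + (1 + length (filter (coprime? 1) (range p)))
      ≡⟨ cong (λ x → C + (1 + x)) (length-coprimeTo-1 p) ⟩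
    C + (1 + (p ∸ 1))
      ≡⟨ +-suc C (p ∸ 1) ⟩
    suc C + (p ∸ 1)
      ≡⟨ cong (_+ (p ∸ 1)) (card-ν-prime pp) ⟨
    card (ν p) (ν? p) + (p ∸ 1) ∎
  part₂ : p ≢ 3 → card ν[ 3 * p , ZeroDivisor ] ν[ 3 * p , zeroDivisor? ]? ≡ card (ν p) (ν? p) + p + ⌈ p ∸ 1 /2⌉
  part₂ p≢3 = begin
    card ν[ 3 * p , ZeroDivisor ] ν[ 3 * p , zeroDivisor? ]?
      ≡⟨ card-ν-zeroDivisor prime[3] pp p≢3 ⟩
    -- The 2 counts (1, 1) and (1, 2) in `coprimePairs≤ 3`. One unit completes `C` to |ν_p|, the
    -- other completes `p ∸ 1` to `p`.
    C + (2 + length (coprimePairs 3 p))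
      ≡⟨ cong (λ x → C + (2 + x)) (trans (length-coprimeRows 1 (2 ∷ []) (range p))
           (cong₂ _+_ (length-coprimeTo-1 p) (trans (length-coprimeRows 2 [] (range p))
             (trans (+-identityʳ _) (length-coprimeTo-2 p))))) ⟩
    C + (2 + ((p ∸ 1) + h))
      ≡⟨ +-suc C (suc (p ∸ 1 + h)) ⟩
    suc C + (suc (p ∸ 1) + h)
      ≡⟨ cong (λ x → suc C + (x + h)) (suc-pred p) ⟩
    suc C + (p + h)
      ≡⟨ +-assoc (suc C) p h ⟨
    suc C + p + h
      ≡⟨ cong (λ x → x + p + h) (card-ν-prime pp) ⟨
    card (ν p) (ν? p) + p + h ∎
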